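{- Let $\epsilon>0$ and let $x\in\mathbb{Z}^n$ be such that $$|x_1|\ge|x_2|\ge\cdots\ge|x_\tau|>0=|x_{\tau+1}|=\cdots=|x_n|,$$ where $\tau=\|x\|_0$ (this ordering is without loss of generality). Define the $(\epsilon/2)$-mass discounted vector $x^{(\epsilon/2)}\in\mathbb{Z}^n$ by $x^{(\epsilon/2)}_i=0$ for $i\le\epsilon\tau/2$ and $x^{(\epsilon/2)}_i=x_i$ for $i>\epsilon\tau/2$. Suppose $P$ is a random prime (with any distribution) such that $$\mathbb{P}\left(\|x^{(\epsilon/2)}\|_0-\|x^{(\epsilon/2)}\|_{0;\mathbb{F}_P}>\tfrac{\epsilon}{2}\|x^{(\epsilon/2)}\|_0\right)\le\frac1{10}.$$ Then $$\mathbb{P}\left(\|x\|_0-\|x\|_{0;\mathbb{F}_P}>\epsilon\|x\|_0\right)\le\frac1{10}.$$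
   Context: For $y=(y_1,\dots,y_n)\in\mathbb{Z}^n$: $\|y\|_0=|\{v: y_v\neq 0\}|$, and for a prime $p$, $\|y\|_{0;\mathbb{F}_p}=|\{v: y_v\not\equiv 0\pmod p\}|$, i.e. the number of nonzero coordinates of $y$ after reduction modulo $p$. -}

module Defs where

open import Data.Empty using (⊥-elim)
open import Data.Fin.Base as Fin using (Fin; toℕ)
open import Data.Fin.Properties using (sequence)
open import Data.Integer.Base as ℤ using (ℤ; +_; 0ℤ)
import Data.Integer.Divisibility.Signed as ℤ
import Data.Integer.Properties as ℤ
open import Data.List.Base using (List; foldr; map; upTo)
open import Data.List.Relation.Unary.All using (All)
open import Data.List.Relation.Unary.Unique.Propositional using (Unique)
open import Data.Nat.Base as ℕ using (ℕ; suc; _⊔_)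
import Data.Nat.Properties as ℕ
open import Data.Nat.Primality using (Prime)
open import Data.Product.Base using (Σ-syntax; ∃-syntax; _×_; _,_; proj₁; proj₂)
open import Data.Rational.Base as ℚ using (ℚ; 0ℚ; 1ℚ; ½; Positive; 1/_)
import Data.Rational.Properties as ℚ
open import Data.Rational.Solver using (module +-*-Solver)
open import Data.Vec.Base using (Vec; lookup; count; tabulate)
open import Data.Vec.Properties using (lookup∘tabulate)
open import Effect.Monad using (RawMonad)
open import Relation.Binary.PropositionalEquality
  using (_≡_; refl; sym; trans; cong; subst; subst₂)
open import Relation.Nullary using (Dec; yes; no; ¬_; ¬?)
open import Relation.Nullary.Decidable using (¬¬-excluded-middle)
open import Relation.Nullary.Negation using (¬¬-Monad)

------------------------------------------------------------------------
-- Real numbers: Cauchy sequences of rationals, compared up to the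
-- setoid equality _≈_.

IsCauchy : (ℕ → ℚ) → Set
IsCauchy s = ∀ δ → 0ℚ ℚ.< δ →
  ∃[ N ] (∀ m n → N ℕ.≤ m → N ℕ.≤ n → ℚ.∣ s m ℚ.- s n ∣ ℚ.< δ)

record ℝ : Set where
  constructor mkℝ
  field
    seq    : ℕ → ℚ
    cauchy : IsCauchy seq

open ℝ public

fromℚ : ℚ → ℝ
fromℚ q .seq _ = q
fromℚ q .cauchy δ 0<δ =
  0 , λ _ _ _ _ → subst (ℚ._< δ) (sym (cong ℚ.∣_∣ (ℚ.+-inverseʳ q))) 0<δ

fromℤ : ℤ → ℝ
fromℤ z = fromℚ (z ℚ./ 1)

fromℕ : ℕ → ℝ
fromℕ k = fromℤ (+ k)

0ℝ : ℝ
0ℝ = fromℚ 0ℚ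

infixl 6 _+_
infixr 7 _·_
infix  4 _<_ _≤_ _≈_

private
  0<½* : ∀ {δ} → 0ℚ ℚ.< δ → 0ℚ ℚ.< ½ ℚ.* δ
  0<½* {δ} 0<δ = subst (ℚ._< ½ ℚ.* δ) (ℚ.*-zeroʳ ½) (ℚ.*-monoʳ-<-pos ½ 0<δ)

  halves : ∀ δ → ½ ℚ.* δ ℚ.+ ½ ℚ.* δ ≡ δ
  halves δ = trans (sym (ℚ.*-distribʳ-+ δ ½ ½)) (ℚ.*-identityˡ δ)

  regroup : ∀ a b c d → (a ℚ.+ b) ℚ.- (c ℚ.+ d) ≡ (a ℚ.- c) ℚ.+ (b ℚ.- d)
  regroup = solve 4 (λ a b c d → (a :+ b) :- (c :+ d) := (a :- c) :+ (b :- d)) refl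
    where open +-*-Solver

  factor : ∀ q a b → q ℚ.* a ℚ.- q ℚ.* b ≡ q ℚ.* (a ℚ.- b)
  factor = solve 3 (λ q a b → q :* a :- q :* b := q :* (a :- b)) refl
    where open +-*-Solver

_+_ : ℝ → ℝ → ℝ
(x + y) .seq n = seq x n ℚ.+ seq y n
(x + y) .cauchy δ 0<δ with cauchy x (½ ℚ.* δ) (0<½* 0<δ) | cauchy y (½ ℚ.* δ) (0<½* 0<δ)
... | M , x-close | N , y-close = M ⊔ N , λ m n h k → begin-strict
    ℚ.∣ (seq x m ℚ.+ seq y m) ℚ.- (seq x n ℚ.+ seq y n) ∣
      ≡⟨ cong ℚ.∣_∣ (regroup (seq x m) (seq y m) (seq x n) (seq y n)) ⟩
    ℚ.∣ (seq x m ℚ.- seq x n) ℚ.+ (seq y m ℚ.- seq y n) ∣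
      ≤⟨ ℚ.∣p+q∣≤∣p∣+∣q∣ (seq x m ℚ.- seq x n) (seq y m ℚ.- seq y n) ⟩
    ℚ.∣ seq x m ℚ.- seq x n ∣ ℚ.+ ℚ.∣ seq y m ℚ.- seq y n ∣
      <⟨ ℚ.+-mono-< (x-close m n (left h) (left k)) (y-close m n (right h) (right k)) ⟩
    ½ ℚ.* δ ℚ.+ ½ ℚ.* δ
      ≡⟨ halves δ ⟩
    δ ∎
  where
  open ℚ.≤-Reasoning
  left : ∀ {m} → M ⊔ N ℕ.≤ m → M ℕ.≤ m
  left = ℕ.≤-trans (ℕ.m≤m⊔n M N)
  right : ∀ {m} → M ⊔ N ℕ.≤ m → N ℕ.≤ m
  right = ℕ.≤-trans (ℕ.m≤n⊔m M N)

_·_ : ℚ → ℝ → ℝ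
(q · x) .seq n = q ℚ.* seq x n
(q · x) .cauchy δ 0<δ = proj₁ close , λ m n h k → begin-strict
    ℚ.∣ q ℚ.* seq x m ℚ.- q ℚ.* seq x n ∣
      ≡⟨ cong ℚ.∣_∣ (factor q (seq x m) (seq x n)) ⟩
    ℚ.∣ q ℚ.* (seq x m ℚ.- seq x n) ∣
      ≡⟨ ℚ.∣p*q∣≡∣p∣*∣q∣ q _ ⟩
    ℚ.∣ q ∣ ℚ.* ℚ.∣ seq x m ℚ.- seq x n ∣
      ≤⟨ ℚ.*-monoʳ-≤-nonNeg ℚ.∣ seq x m ℚ.- seq x n ∣ {{ℚ.∣-∣-nonNeg (seq x m ℚ.- seq x n)}} ∣q∣≤c ⟩
    c ℚ.* ℚ.∣ seq x m ℚ.- seq x n ∣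
      <⟨ ℚ.*-monoʳ-<-pos c (proj₂ close m n h k) ⟩
    c ℚ.* (1/ c ℚ.* δ)
      ≡⟨ sym (ℚ.*-assoc c (1/ c) δ) ⟩
    (c ℚ.* 1/ c) ℚ.* δ
      ≡⟨ cong (ℚ._* δ) (ℚ.*-inverseʳ c) ⟩
    1ℚ ℚ.* δ
      ≡⟨ ℚ.*-identityˡ δ ⟩
    δ ∎
  where
  open ℚ.≤-Reasoning
  c : ℚ
  c = 1ℚ ℚ.+ ℚ.∣ q ∣
  instance
    c-pos : Positive c
    c-pos = ℚ.pos+nonNeg⇒pos 1ℚ ℚ.∣ q ∣ {{ℚ.∣-∣-nonNeg q}}
    c-nonZero : ℚ.NonZero c
    c-nonZero = ℚ.pos⇒nonZero c
    1/c-pos : Positive (1/ c)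
    1/c-pos = ℚ.1/pos⇒pos c
  ∣q∣≤c : ℚ.∣ q ∣ ℚ.≤ c
  ∣q∣≤c = subst (ℚ._≤ c) (ℚ.+-identityˡ ℚ.∣ q ∣)
            (ℚ.+-monoˡ-≤ ℚ.∣ q ∣ (ℚ.<⇒≤ (ℚ.positive⁻¹ 1ℚ)))
  close = cauchy x (1/ c ℚ.* δ)
            (subst (ℚ._< 1/ c ℚ.* δ) (ℚ.*-zeroʳ (1/ c)) (ℚ.*-monoʳ-<-pos (1/ c) 0<δ))

_<_ : ℝ → ℝ → Set
x < y = ∃[ δ ] (0ℚ ℚ.< δ × ∃[ N ] (∀ n → N ℕ.≤ n → seq x n ℚ.+ δ ℚ.≤ seq y n))

_≤_ : ℝ → ℝ → Set
x ≤ y = ¬ (y < x)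

_≈_ : ℝ → ℝ → Set
x ≈ y = x ≤ y × y ≤ x

_⟶_ : (ℕ → ℝ) → ℚ → Set
s ⟶ l = ∀ δ → 0ℚ ℚ.< δ →
  ∃[ N ] (∀ n → N ℕ.≤ n → fromℚ (l ℚ.- δ) < s n × s n < fromℚ (l ℚ.+ δ))

∑ : (ℕ → ℝ) → List ℕ → ℝ
∑ f ks = foldr _+_ 0ℝ (map f ks)

------------------------------------------------------------------------
-- Random primes

-- The law of a random prime, as a mass function on ℕ supported on the
-- primes.
record RandomPrime : Set where
  field
    mass     : ℕ → ℝ
    mass≥0   : ∀ k → 0ℝ ≤ mass k
    support  : ∀ k → ¬ Prime k → mass k ≈ 0ℝ
    total    : (λ n → ∑ mass (upTo n)) ⟶ 1ℚ

open RandomPrime public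

-- ℙ[ P ∈ E ] is the supremum of the sums of the masses over the finite
-- subsets of E.  For an undecidable E this supremum need not be a Cauchy
-- real, so it is given by its lower cut { q ∈ ℚ | q < sup }.
LowerReal : Set₁
LowerReal = ℚ → Set

infix 4 _≤ˡ_

_≤ˡ_ : LowerReal → ℚ → Set
L ≤ˡ c = ∀ q → L q → q ℚ.< c

ℙ[_∈_] : RandomPrime → (ℕ → Set) → LowerReal
ℙ[ P ∈ E ] q = Σ[ ks ∈ List ℕ ] (Unique ks × All E ks × fromℚ q < ∑ (mass P) ks)

------------------------------------------------------------------------
-- Integer vectors

‖_‖₀ : ∀ {n} → Vec ℤ n → ℕ
‖ y ‖₀ = count (λ z → ¬? (z ℤ.≟ 0ℤ)) y

‖_‖₀mod_ : ∀ {n} → Vec ℤ n → ℕ → ℕ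
‖ y ‖₀mod p = count (λ z → ¬? (+ p ℤ.∣? z)) y

-- Coordinates are numbered from 1: x_(index i) is lookup x i.
index : ∀ {n} → Fin n → ℕ
index i = suc (toℕ i)

record IsOrdered {n} (x : Vec ℤ n) : Set where
  field
    decreasing : ∀ i j → i Fin.≤ j → index j ℕ.≤ ‖ x ‖₀ →
                 ℤ.∣ lookup x j ∣ ℕ.≤ ℤ.∣ lookup x i ∣
    positive   : ∀ i → index i ℕ.≤ ‖ x ‖₀ → 0 ℕ.< ℤ.∣ lookup x i ∣
    vanishing  : ∀ i → ‖ x ‖₀ ℕ.< index i → ℤ.∣ lookup x i ∣ ≡ 0

-- y is the θ-mass discounted vector of x.  Since the order on ℝ is not
-- decidable, y is specified by its defining property instead of being
-- computed from θ.  There is at most one such y (discounted-unique), and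
-- classically there is one (discounted-¬¬exists).
record IsMassDiscounted {n} (θ : ℝ) (x y : Vec ℤ n) : Set where
  field
    discarded : ∀ i → fromℕ (index i) ≤ (+ ‖ x ‖₀ ℚ./ 1) · θ → lookup y i ≡ 0ℤ
    kept      : ∀ i → (+ ‖ x ‖₀ ℚ./ 1) · θ < fromℕ (index i) → lookup y i ≡ lookup x i

discounted-unique : ∀ {n θ} {x y z : Vec ℤ n} →
  IsMassDiscounted θ x y → IsMassDiscounted θ x z → ∀ i → lookup y i ≡ lookup z i
discounted-unique {y = y} {z} Y Z i with lookup y i ℤ.≟ lookup z i
... | yes eq = eq
... | no  ne = ⊥-elim (ne (trans (Y .discarded i i≤) (sym (Z .discarded i i≤))))
  where
  open IsMassDiscounted
  i≤ = λ i> → ne (trans (Y .kept i i>) (sym (Z .kept i i>)))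

discounted-¬¬exists : ∀ {n} (θ : ℝ) (x : Vec ℤ n) → ¬ ¬ (∃[ y ] IsMassDiscounted θ x y)
discounted-¬¬exists {n} θ x ¬ex =
  sequence (RawMonad.rawApplicative ¬¬-Monad) (λ _ → ¬¬-excluded-middle)
    (λ dec → ¬ex (tabulate (λ i → entry i (dec i)) , record
      { discarded = λ i h → trans (lookup∘tabulate _ i) (entry-discarded i (dec i) h)
      ; kept      = λ i h → trans (lookup∘tabulate _ i) (entry-kept i (dec i) h)
      }))
  where
  Kept : Fin n → Set
  Kept i = (+ ‖ x ‖₀ ℚ./ 1) · θ < fromℕ (index i)
  entry : ∀ i → Dec (Kept i) → ℤ
  entry i (yes _) = lookup x i
  entry i (no  _) = 0ℤ
  entry-discarded : ∀ i (d : Dec (Kept i)) → ¬ Kept i → entry i d ≡ 0ℤ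
  entry-discarded i (yes h) ¬h = ⊥-elim (¬h h)
  entry-discarded i (no  _) _  = refl
  entry-kept : ∀ i (d : Dec (Kept i)) → Kept i → entry i d ≡ lookup x i
  entry-kept i (yes _)  _ = refl
  entry-kept i (no  ¬h) h = ⊥-elim (¬h h)

-- ‖y‖₀ − ‖y‖₀mod p > θ ‖y‖₀
LosesMoreThan : ∀ {n} → ℝ → Vec ℤ n → ℕ → Set
LosesMoreThan θ y p =
  (+ ‖ y ‖₀ ℚ./ 1) · θ < fromℤ (+ ‖ y ‖₀ ℤ.- + (‖ y ‖₀mod p))

{-# OPTIONS --safe #-}

-- Let y be the discounted vector.  If x and y differ, let i be the last
-- coordinate at which they do; then index i ≤ ετ/2, and at most index i of the
-- coordinates lost by x modulo p are not lost by y.  So if x loses more than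
-- ετ coordinates, then y loses more than ετ − ετ/2 = ετ/2 ≥ (ε/2)‖y‖₀ of them.
-- The event for x is thus contained in the event for y, for every p.

module Submission where

open import Defs
open import Data.Empty using (⊥-elim)
open import Data.Fin.Base using (zero; suc)
open import Data.Integer.Base as ℤ using (ℤ; +_; 0ℤ)
import Data.Integer.Divisibility.Signed as ℤ
import Data.Integer.Properties as ℤ
import Data.Integer.Solver as ℤSolver
import Data.List.Relation.Unary.All as All
open import Data.Nat.Base as ℕ using (ℕ; suc; _⊔_)
import Data.Nat.Properties as ℕ
open import Data.Product.Base using (∃-syntax; _×_; _,_)
open import Data.Rational.Base as ℚ using (ℚ; 0ℚ; ½; _/_)
import Data.Rational.Properties as ℚ
import Data.Rational.Solver as ℚSolver
import Data.Rational.Unnormalised.Base as ℚᵘ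
import Data.Rational.Unnormalised.Properties as ℚᵘ
open import Data.Sum.Base using (_⊎_; inj₁; inj₂)
open import Data.Vec.Base using (Vec; []; _∷_; lookup; count)
open import Function.Base using (_∘_)
open import Relation.Binary.PropositionalEquality
  using (_≡_; _≢_; refl; sym; cong; subst)
open import Relation.Nullary using (yes; no; ¬?; contradiction)
open import Relation.Unary using (Decidable; _⊆_)

module _ {A : Set} {P : A → Set} (P? : Decidable P) where

  count-∷-≥ : ∀ {n} a (xs : Vec A n) → count P? xs ℕ.≤ count P? (a ∷ xs)
  count-∷-≥ a xs with P? a
  ... | yes _ = ℕ.n≤1+n _
  ... | no  _ = ℕ.≤-refl

  count-∷-≤ : ∀ {n} a (xs : Vec A n) → count P? (a ∷ xs) ℕ.≤ suc (count P? xs)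
  count-∷-≤ a xs with P? a
  ... | yes _ = ℕ.≤-refl
  ... | no  _ = ℕ.n≤1+n _

  count-∷-> : ∀ {n a} (xs : Vec A n) → P a → count P? xs ℕ.< count P? (a ∷ xs)
  count-∷-> {a = a} xs pa with P? a
  ... | yes _  = ℕ.≤-refl
  ... | no ¬pa = contradiction pa ¬pa

  count-mono : ∀ {n} (xs ys : Vec A n) →
    (∀ i → P (lookup xs i) → P (lookup ys i)) → count P? xs ℕ.≤ count P? ys
  count-mono []       []       _ = ℕ.z≤n
  count-mono (a ∷ xs) (b ∷ ys) h with P? a | P? b
  ... | yes _  | yes _  = ℕ.s≤s (count-mono xs ys (h ∘ suc))
  ... | yes pa | no ¬pb = contradiction (h zero pa) ¬pb
  ... | no  _  | yes _  = ℕ.m≤n⇒m≤1+n (count-mono xs ys (h ∘ suc))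
  ... | no  _  | no  _  = count-mono xs ys (h ∘ suc)

-- A bound on the change of count P? − count Q? between two vectors, with
-- all terms moved so that no subtraction occurs.
module _ {A : Set} {P Q : A → Set} (P? : Decidable P) (Q? : Decidable Q) (Q⊆P : Q ⊆ P) where

  count-difference-∷ : ∀ {n} k a b (xs ys : Vec A n) →
    count P? xs ℕ.+ count Q? ys ℕ.≤ k ℕ.+ (count P? ys ℕ.+ count Q? xs) →
    count P? (a ∷ xs) ℕ.+ count Q? (b ∷ ys) ℕ.≤
      suc k ℕ.+ (count P? (b ∷ ys) ℕ.+ count Q? (a ∷ xs))
  count-difference-∷ k a b xs ys h with Q? b
  -- By `Q⊆P`, `b` is counted by `P?` as well, so the extra one on the left is matched on the right.
  -- The one in `suc k` pays for `a`, which `P?` may count while `Q?` does not.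
  ... | yes qb = begin
    count P? (a ∷ xs) ℕ.+ suc (count Q? ys)
      ≡⟨ ℕ.+-suc _ _ ⟩
    suc (count P? (a ∷ xs) ℕ.+ count Q? ys)
      ≤⟨ ℕ.s≤s (ℕ.+-monoˡ-≤ _ (count-∷-≤ P? a xs)) ⟩
    suc (suc (count P? xs ℕ.+ count Q? ys))
      ≤⟨ ℕ.s≤s (ℕ.s≤s h) ⟩
    suc (suc (k ℕ.+ (count P? ys ℕ.+ count Q? xs)))
      ≡⟨ cong suc (ℕ.+-suc k _) ⟨
    suc k ℕ.+ (suc (count P? ys) ℕ.+ count Q? xs)
      ≤⟨ ℕ.+-monoʳ-≤ (suc k) (ℕ.+-mono-≤ (count-∷-> P? ys (Q⊆P qb)) (count-∷-≥ Q? a xs)) ⟩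
    suc k ℕ.+ (count P? (b ∷ ys) ℕ.+ count Q? (a ∷ xs)) ∎
    where open ℕ.≤-Reasoning
  ... | no _ = begin
    count P? (a ∷ xs) ℕ.+ count Q? ys
      ≤⟨ ℕ.+-monoˡ-≤ _ (count-∷-≤ P? a xs) ⟩
    suc (count P? xs ℕ.+ count Q? ys)
      ≤⟨ ℕ.s≤s h ⟩
    suc k ℕ.+ (count P? ys ℕ.+ count Q? xs)
      ≤⟨ ℕ.+-monoʳ-≤ (suc k) (ℕ.+-mono-≤ (count-∷-≥ P? b ys) (count-∷-≥ Q? a xs)) ⟩
    suc k ℕ.+ (count P? (b ∷ ys) ℕ.+ count Q? (a ∷ xs)) ∎
    where open ℕ.≤-Reasoning

nonzero-difference-∷ : ∀ {n} p k a b (x y : Vec ℤ n) →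
  ‖ x ‖₀ ℕ.+ ‖ y ‖₀mod p ℕ.≤ k ℕ.+ (‖ y ‖₀ ℕ.+ ‖ x ‖₀mod p) →
  ‖ a ∷ x ‖₀ ℕ.+ ‖ b ∷ y ‖₀mod p ℕ.≤ suc k ℕ.+ (‖ b ∷ y ‖₀ ℕ.+ ‖ a ∷ x ‖₀mod p)
nonzero-difference-∷ p = count-difference-∷ (λ z → ¬? (z ℤ.≟ 0ℤ)) (λ z → ¬? (+ p ℤ.∣? z))
  -- The inclusion `Q⊆P` holds because every `p` divides 0.
  λ { p∤0 refl → p∤0 (ℤ.divides 0ℤ refl) }

-- Equality of integers is decidable, unlike the order on `ℝ`, so the last disagreement can be
-- computed. The recursion finds it from the end: past it the two losses agree, and each coordinate
-- up to it raises the loss of `x` over that of `y` by at most one.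
lost-modulo-≤ : ∀ {n} p (x y : Vec ℤ n) →
  x ≡ y ⊎
  ∃[ i ] (lookup y i ≢ lookup x i ×
    ‖ x ‖₀ ℕ.+ ‖ y ‖₀mod p ℕ.≤ index i ℕ.+ (‖ y ‖₀ ℕ.+ ‖ x ‖₀mod p))
lost-modulo-≤ p [] [] = inj₁ refl
lost-modulo-≤ p (a ∷ x) (b ∷ y) with lost-modulo-≤ p x y
... | inj₂ (i , ne , h) = inj₂ (suc i , ne , nonzero-difference-∷ p (index i) a b x y h)
... | inj₁ refl with b ℤ.≟ a
...   | yes refl = inj₁ refl
-- Equal tails need no allowance, hence 0; the head adds one, and `index zero` is 1.
...   | no  ne   = inj₂ (zero , ne , nonzero-difference-∷ p 0 a b x x ℕ.≤-refl)

p≤∣p∣ : ∀ p → p ℚ.≤ ℚ.∣ p ∣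
p≤∣p∣ p with ℚ.≤-total 0ℚ p
... | inj₁ 0≤p = ℚ.≤-reflexive (sym (ℚ.0≤p⇒∣p∣≡p 0≤p))
... | inj₂ p≤0 = ℚ.≤-trans p≤0 (ℚ.0≤∣p∣ p)

∣p-q∣<η⇒p≤q+η : ∀ p q {η} → ℚ.∣ p ℚ.- q ∣ ℚ.< η → p ℚ.≤ q ℚ.+ η
∣p-q∣<η⇒p≤q+η p q {η} close = begin
  p                  ≡⟨ solve 2 (λ p q → p := q :+ (p :- q)) refl p q ⟩
  q ℚ.+ (p ℚ.- q)    ≤⟨ ℚ.+-monoʳ-≤ q (ℚ.≤-trans (p≤∣p∣ _) (ℚ.<⇒≤ close)) ⟩
  q ℚ.+ η            ∎
  where
  open ℚ.≤-Reasoning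
  open ℚSolver.+-*-Solver

0<½*p : ∀ {p} → 0ℚ ℚ.< p → 0ℚ ℚ.< ½ ℚ.* p
0<½*p {p} 0<p = subst (ℚ._< ½ ℚ.* p) (ℚ.*-zeroʳ ½) (ℚ.*-monoʳ-<-pos ½ 0<p)

-- The fraction `i / 1` is normalised by a gcd and does not reduce for a variable `i`. The
-- unnormalised `mkℚᵘ i 0`, whose 0 is the denominator minus one, does compute, so facts about `/ 1`
-- are proved there.
toℚᵘ-/1 : ∀ i → ℚ.toℚᵘ (i / 1) ℚᵘ.≃ ℚᵘ.mkℚᵘ i 0
toℚᵘ-/1 i = ℚ.toℚᵘ-fromℚᵘ (ℚᵘ.mkℚᵘ i 0)

/1-mono-≤ : ∀ {i j} → i ℤ.≤ j → i / 1 ℚ.≤ j / 1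
/1-mono-≤ {i} {j} i≤j = ℚ.toℚᵘ-cancel-≤ (begin
  ℚ.toℚᵘ (i / 1)   ≃⟨ toℚᵘ-/1 i ⟩
  ℚᵘ.mkℚᵘ i 0      ≤⟨ ℚᵘ.*≤* (ℤ.*-monoʳ-≤-nonNeg (+ 1) i≤j) ⟩
  ℚᵘ.mkℚᵘ j 0      ≃⟨ toℚᵘ-/1 j ⟨
  ℚ.toℚᵘ (j / 1)   ∎)
  where open ℚᵘ.≤-Reasoning

/1-homo-+ : ∀ i j → (i ℤ.+ j) / 1 ≡ i / 1 ℚ.+ j / 1
/1-homo-+ i j = ℚ.toℚᵘ-injective (begin-equality
  ℚ.toℚᵘ ((i ℤ.+ j) / 1)                     ≃⟨ toℚᵘ-/1 (i ℤ.+ j) ⟩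
  ℚᵘ.mkℚᵘ (i ℤ.+ j) 0                        ≃⟨ ℚᵘ.*≡* (solve 2 (λ i j →
      (i :+ j) :* (con (+ 1) :* con (+ 1)) := (i :* con (+ 1) :+ j :* con (+ 1)) :* con (+ 1)) refl i j) ⟩
  ℚᵘ.mkℚᵘ i 0 ℚᵘ.+ ℚᵘ.mkℚᵘ j 0               ≃⟨ ℚᵘ.+-cong (toℚᵘ-/1 i) (toℚᵘ-/1 j) ⟨
  ℚ.toℚᵘ (i / 1) ℚᵘ.+ ℚ.toℚᵘ (j / 1)         ≃⟨ ℚ.toℚᵘ-homo-+ (i / 1) (j / 1) ⟨
  ℚ.toℚᵘ (i / 1 ℚ.+ j / 1)                   ∎)
  where
  open ℚᵘ.≤-Reasoning
  open ℤSolver.+-*-Solver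

-- The negation in `x ≤ y` becomes usable because order on `ℚ` is decidable: a gap of `δ` at a
-- single late index would persist and so witness `y < x`.
≤⇒eventually-≤ : ∀ x y → x ≤ y → ∀ δ → 0ℚ ℚ.< δ →
  ∃[ N ] (∀ n → N ℕ.≤ n → seq x n ℚ.≤ seq y n ℚ.+ δ)
≤⇒eventually-≤ x y x≤y δ 0<δ
  with cauchy x (½ ℚ.* (½ ℚ.* δ)) (0<½*p (0<½*p 0<δ))
     | cauchy y (½ ℚ.* (½ ℚ.* δ)) (0<½*p (0<½*p 0<δ))
... | M , x-close | N , y-close = M ⊔ N , bound
  where
  η = ½ ℚ.* (½ ℚ.* δ)

  -- Moving from `n` to `m` costs a quarter of `δ` in each sequence, which leaves half of the gap.
  stays-apart : ∀ n → M ⊔ N ℕ.≤ n → seq y n ℚ.+ δ ℚ.≤ seq x n →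
    ∀ m → M ⊔ N ℕ.≤ m → seq y m ℚ.+ ½ ℚ.* δ ℚ.≤ seq x m
  stays-apart n n≥ apart m m≥ = begin
    seq y m ℚ.+ ½ ℚ.* δ
      ≤⟨ ℚ.+-monoˡ-≤ _ (∣p-q∣<η⇒p≤q+η (seq y m) (seq y n)
           (y-close m n (ℕ.m⊔n≤o⇒n≤o M N m≥) (ℕ.m⊔n≤o⇒n≤o M N n≥))) ⟩
    seq y n ℚ.+ η ℚ.+ ½ ℚ.* δ
      ≡⟨ solve 2 (λ y δ → y :+ con ½ :* (con ½ :* δ) :+ con ½ :* δ
                       := y :+ δ :- con ½ :* (con ½ :* δ)) refl (seq y n) δ ⟩
    seq y n ℚ.+ δ ℚ.- η
      ≤⟨ ℚ.+-monoˡ-≤ (ℚ.- η) (ℚ.≤-trans apart (∣p-q∣<η⇒p≤q+η (seq x n) (seq x m)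
           (x-close n m (ℕ.m⊔n≤o⇒m≤o M N n≥) (ℕ.m⊔n≤o⇒m≤o M N m≥)))) ⟩
    seq x m ℚ.+ η ℚ.- η
      ≡⟨ solve 2 (λ x η → x :+ η :- η := x) refl (seq x m) η ⟩
    seq x m ∎
    where
    open ℚ.≤-Reasoning
    open ℚSolver.+-*-Solver

  bound : ∀ n → M ⊔ N ℕ.≤ n → seq x n ℚ.≤ seq y n ℚ.+ δ
  bound n n≥ with ℚ.≤-total (seq x n) (seq y n ℚ.+ δ)
  ... | inj₁ le = le
  ... | inj₂ ge = ⊥-elim (x≤y (½ ℚ.* δ , 0<½*p 0<δ , M ⊔ N , stays-apart n n≥ ge))

0<⇒eventually-0≤ : ∀ x → 0ℝ < x → ∃[ N ] (∀ n → N ℕ.≤ n → 0ℚ ℚ.≤ seq x n)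
0<⇒eventually-0≤ x (δ , 0<δ , N , h) = N , λ n n≥ →
  ℚ.≤-trans (ℚ.<⇒≤ 0<δ) (subst (ℚ._≤ seq x n) (ℚ.+-identityˡ δ) (h n n≥))

0≤q·x : ∀ q .{{_ : ℚ.NonNegative q}} x → 0ℝ < x → 0ℝ ≤ q · x
0≤q·x q x 0<x (δ , 0<δ , N , h) with 0<⇒eventually-0≤ x 0<x
... | M , x≥0 = ℚ.<-irrefl refl (begin-strict
    0ℚ                     <⟨ 0<δ ⟩
    δ                      ≡⟨ ℚ.+-identityˡ δ ⟨
    0ℚ ℚ.+ δ               ≡⟨ cong (ℚ._+ δ) (ℚ.*-zeroʳ q) ⟨
    q ℚ.* 0ℚ ℚ.+ δ         ≤⟨ ℚ.+-monoˡ-≤ δ (ℚ.*-monoˡ-≤-nonNeg q (x≥0 _ (ℕ.m≤m⊔n M N))) ⟩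
    q ℚ.* seq x (M ⊔ N) ℚ.+ δ  ≤⟨ h _ (ℕ.m≤n⊔m M N) ⟩
    0ℚ                     ∎)
  where open ℚ.≤-Reasoning

fromℕ-nonNeg : ∀ k → ℚ.NonNegative (+ k / 1)
fromℕ-nonNeg k = ℚ.nonNegative (/1-mono-≤ {0ℤ} {+ k} (ℤ.+≤+ ℕ.z≤n))

0≤τ½ε : ∀ τ ε → 0ℝ < ε → 0ℝ ≤ (+ τ / 1) · ½ · ε
0≤τ½ε τ ε 0<ε = 0≤q·x (+ τ / 1) {{fromℕ-nonNeg τ}} (½ · ε) 0<½ε
  where
  0<½ε : 0ℝ < ½ · ε
  0<½ε = let δ , 0<δ , N , h = 0<ε in
    ½ ℚ.* δ , 0<½*p 0<δ , N , λ n n≥ →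
      subst (ℚ._≤ _) (solve 1 (λ δ → con ½ :* (con 0ℚ :+ δ) := con 0ℚ :+ con ½ :* δ) refl δ)
        (ℚ.*-monoˡ-≤-nonNeg ½ (h n n≥))
    where open ℚSolver.+-*-Solver

-- There is no case split on whether a coordinate is kept. If `x` vanishes at it and `y` does not,
-- then it cannot be kept, and this refutation is exactly the premise of `discarded`.
‖‖₀-discounted-≤ : ∀ {n θ} {x y : Vec ℤ n} → IsMassDiscounted θ x y → ‖ y ‖₀ ℕ.≤ ‖ x ‖₀
‖‖₀-discounted-≤ {x = x} {y} D = count-mono (λ z → ¬? (z ℤ.≟ 0ℤ)) y x
  λ i yᵢ≢0 xᵢ≡0 → yᵢ≢0 (D .discarded i λ i> → yᵢ≢0 (subst (_≡ 0ℤ) (sym (D .kept i i>)) xᵢ≡0))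
  where open IsMassDiscounted

-- Here `k` stands in for the integer part of ετ/2, which cannot be computed from a Cauchy real.
lost-discounted-≤ : ∀ {n ε} {x y : Vec ℤ n} p → 0ℝ < ε → IsMassDiscounted (½ · ε) x y →
  ∃[ k ] (fromℕ k ≤ (+ ‖ x ‖₀ / 1) · ½ · ε ×
    ‖ x ‖₀ ℕ.+ ‖ y ‖₀mod p ℕ.≤ k ℕ.+ (‖ y ‖₀ ℕ.+ ‖ x ‖₀mod p))
lost-discounted-≤ {ε = ε} {x} {y} p 0<ε D with lost-modulo-≤ p x y
... | inj₁ refl         = 0 , 0≤τ½ε ‖ x ‖₀ ε 0<ε , ℕ.≤-refl
-- A coordinate where `x` and `y` differ is not kept; as `≤` is a negated `<`, this is the required
-- bound on `index i`.
... | inj₂ (i , ne , h) = index i , ne ∘ IsMassDiscounted.kept D i , h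

losses-/1-≤ : ∀ a b c d k → a ℕ.+ d ℕ.≤ k ℕ.+ (c ℕ.+ b) →
  (+ a ℤ.- + b) / 1 ℚ.≤ + k / 1 ℚ.+ (+ c ℤ.- + d) / 1
losses-/1-≤ a b c d k h = subst (_ ℚ.≤_) (/1-homo-+ (+ k) (+ c ℤ.- + d)) (/1-mono-≤ {+ a ℤ.- + b} {+ k ℤ.+ (+ c ℤ.- + d)} (begin
  + a ℤ.- + b
    ≡⟨ solve 3 (λ a b d → a :- b := a :+ d :- (b :+ d)) refl (+ a) (+ b) (+ d) ⟩
  + (a ℕ.+ d) ℤ.- (+ b ℤ.+ + d)
    ≤⟨ ℤ.+-monoˡ-≤ (ℤ.- (+ b ℤ.+ + d)) (ℤ.+≤+ h) ⟩
  + k ℤ.+ (+ c ℤ.+ + b) ℤ.- (+ b ℤ.+ + d)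
    ≡⟨ solve 4 (λ b c d k → k :+ (c :+ b) :- (b :+ d) := k :+ (c :- d)) refl (+ b) (+ c) (+ d) (+ k) ⟩
  + k ℤ.+ (+ c ℤ.- + d) ∎))
  where
  open ℤ.≤-Reasoning
  open ℤSolver.+-*-Solver

-- The main estimate at one term `e` of ε: `τ` and `σ` are the numbers of nonzero coordinates of the
-- two vectors, `l` and `m` their losses. Half of the margin `δ` pays for the bound on `k` being
-- only approximate; the other half survives as the margin for `y`.
loss-transfer : ∀ τ σ e δ k l m → 0ℚ ℚ.≤ e → σ ℚ.≤ τ →
  τ ℚ.* e ℚ.+ δ ℚ.≤ l → k ℚ.≤ τ ℚ.* (½ ℚ.* e) ℚ.+ ½ ℚ.* δ → l ℚ.≤ k ℚ.+ m →
  σ ℚ.* (½ ℚ.* e) ℚ.+ ½ ℚ.* δ ℚ.≤ m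
loss-transfer τ σ e δ k l m 0≤e σ≤τ τe<l k≤ l≤k+m = begin
  σ ℚ.* (½ ℚ.* e) ℚ.+ ½ ℚ.* δ
    ≤⟨ ℚ.+-monoˡ-≤ (½ ℚ.* δ) (ℚ.*-monoʳ-≤-nonNeg (½ ℚ.* e) {{½e≥0}} σ≤τ) ⟩
  τ ℚ.* (½ ℚ.* e) ℚ.+ ½ ℚ.* δ
    ≡⟨ solve 3 (λ τ e δ → τ :* (con ½ :* e) :+ con ½ :* δ
         := τ :* e :+ δ :- (τ :* (con ½ :* e) :+ con ½ :* δ)) refl τ e δ ⟩
  τ ℚ.* e ℚ.+ δ ℚ.- (τ ℚ.* (½ ℚ.* e) ℚ.+ ½ ℚ.* δ)
    ≤⟨ ℚ.+-mono-≤ τe<l (ℚ.neg-antimono-≤ k≤) ⟩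
  l ℚ.- k
    ≤⟨ ℚ.+-monoˡ-≤ (ℚ.- k) l≤k+m ⟩
  k ℚ.+ m ℚ.- k
    ≡⟨ solve 2 (λ k m → k :+ m :- k := m) refl k m ⟩
  m ∎
  where
  open ℚ.≤-Reasoning
  open ℚSolver.+-*-Solver
  ½e≥0 : ℚ.NonNegative (½ ℚ.* e)
  ½e≥0 = ℚ.nonNegative (ℚ.*-monoˡ-≤-nonNeg ½ 0≤e)

discounted-loses : ∀ {n ε} {x y : Vec ℤ n} {p} → 0ℝ < ε → IsMassDiscounted (½ · ε) x y →
  LosesMoreThan ε x p → LosesMoreThan (½ · ε) y p
discounted-loses {ε = ε} {x} {y} {p} 0<ε D (δ , 0<δ , L , x-loses) =
  let k , k≤ , h = lost-discounted-≤ {ε = ε} {x} {y} p 0<ε D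
      M , k-small = ≤⇒eventually-≤ (fromℕ k) ((+ ‖ x ‖₀ / 1) · ½ · ε) k≤ (½ ℚ.* δ) (0<½*p 0<δ)
      N , ε≥0 = 0<⇒eventually-0≤ ε 0<ε
  in
  -- Past `L` the loss of `x` has margin `δ`, past `M` the bound on `k` holds up to half of `δ`, and
  -- past `N` the terms of ε are nonnegative.
  ½ ℚ.* δ , 0<½*p 0<δ , L ⊔ (M ⊔ N) , λ n n≥ →
  let n≥M⊔N = ℕ.m⊔n≤o⇒n≤o L (M ⊔ N) n≥ in
  loss-transfer (+ ‖ x ‖₀ / 1) (+ ‖ y ‖₀ / 1) (seq ε n) δ (+ k / 1)
    ((+ ‖ x ‖₀ ℤ.- + (‖ x ‖₀mod p)) / 1) ((+ ‖ y ‖₀ ℤ.- + (‖ y ‖₀mod p)) / 1)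
    (ε≥0 n (ℕ.m⊔n≤o⇒n≤o M N n≥M⊔N))
    (/1-mono-≤ {+ ‖ y ‖₀} {+ ‖ x ‖₀} (ℤ.+≤+ (‖‖₀-discounted-≤ {x = x} {y} D)))
    (x-loses n (ℕ.m⊔n≤o⇒m≤o L (M ⊔ N) n≥))
    (k-small n (ℕ.m⊔n≤o⇒m≤o M N n≥M⊔N))
    (losses-/1-≤ ‖ x ‖₀ (‖ x ‖₀mod p) ‖ y ‖₀ (‖ y ‖₀mod p) k h)

theorem5 : (ε : ℝ) → 0ℝ < ε →
    (n : ℕ) (x : Vec ℤ n) → IsOrdered x →
    (x⁽ε/2⁾ : Vec ℤ n) → IsMassDiscounted (½ · ε) x x⁽ε/2⁾ →
    (P : RandomPrime) →
    ℙ[ P ∈ LosesMoreThan (½ · ε) x⁽ε/2⁾ ] ≤ˡ (+ 1 / 10) →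
    ℙ[ P ∈ LosesMoreThan ε x ] ≤ˡ (+ 1 / 10)
theorem5 ε 0<ε n x _ y D P ℙ≤ q (ks , unique , lost , q<∑) =
  ℙ≤ q (ks , unique , All.map (discounted-loses {ε = ε} {x} {y} 0<ε D) lost , q<∑)
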